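{- Let $I$ be a finite interval in $\mathbb Z$ containing $M$ integers and let $x_m\in\mathbb C$ for $m\in I$. Assume that $K\subset\mathbb N$ is a finite nonempty set. Then \[ \left|\sum_{m\in I}x_m\right|^2\le\frac{M+\max K-\min K}{|K|^2}\sum_{k_1,k_2\in K}\ \sum_{\substack{m\in\mathbb Z\\ m,\,m+k_1-k_2\in I}}x_m\overline{x_{m+k_1-k_2}}. \]
   Context: $\mathbb N$ denotes the set of nonnegative integers and $|K|$ the cardinality of $K$. (The right-hand side is a real number.) -}

module Defs where

open import Data.Integer as ℤ using (ℤ; +_)
import Data.Integer.Properties as ℤ
import Data.Integer.Solver as ℤ-Solver
open import Data.List using (List; foldr; map)
open import Data.List.Extrema.Nat using (max; min)
open import Data.List.Membership.Propositional using (_∈_)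
open import Data.List.NonEmpty using (List⁺; _∷_)
open import Data.Nat as ℕ using (ℕ; zero; suc)
import Data.Nat.DivMod as ℕ
import Data.Nat.Properties as ℕ
open import Data.Product using (∃; ∃₂; _×_; _,_; proj₁; proj₂)
open import Data.Rational as ℚ using (ℚ; mkℚ; 0ℚ; 1ℚ; ½; ∣_∣; _+_; _-_; _*_; -_; _≤_; _<_; _/_; toℚᵘ)
import Data.Rational.Properties as ℚ
open import Data.Rational.Solver using (module +-*-Solver)
open import Data.Rational.Unnormalised as ℚᵘ using (mkℚᵘ; *≤*; *≡*)
import Data.Rational.Unnormalised.Properties as ℚᵘ
open import Data.Sum using (inj₁; inj₂)
open import Function.Bundles using (_⇔_)
open import Relation.Binary.PropositionalEquality
open import Relation.Nullary using (yes; no; contradiction)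

open +-*-Solver using (solve; _:=_; _:+_; _:*_; _:-_; :-_; con)

private
  ½*-pos : ∀ {ε} → 0ℚ < ε → 0ℚ < ½ * ε
  ½*-pos {ε} ε>0 = ℚ.positive⁻¹ (½ * ε)
    where instance
      _ = ℚ.positive ε>0
      _ = ℚ.pos*pos⇒pos ½ ε

  *-pos : ∀ {p q} → 0ℚ < p → 0ℚ < q → 0ℚ < p * q
  *-pos {p} {q} p>0 q>0 = ℚ.positive⁻¹ (p * q)
    where instance
      _ = ℚ.positive p>0
      _ = ℚ.positive q>0
      _ = ℚ.pos*pos⇒pos p q

  ½+½ : ∀ ε → ½ * ε + ½ * ε ≡ ε
  ½+½ = solve 1 (λ e → con ½ :* e :+ con ½ :* e := e) refl

  *-mono-≤ : ∀ {p q r s} → 0ℚ ≤ p → 0ℚ ≤ s → p ≤ q → r ≤ s → p * r ≤ q * s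
  *-mono-≤ {p} {q} {r} {s} p≥0 s≥0 p≤q r≤s = ℚ.≤-trans
    (ℚ.*-monoˡ-≤-nonNeg p r≤s) (ℚ.*-monoʳ-≤-nonNeg s p≤q)
    where instance
      _ = ℚ.nonNegative p≥0
      _ = ℚ.nonNegative s≥0

  ∣-∣-sym : ∀ p q → ∣ p - q ∣ ≡ ∣ q - p ∣
  ∣-∣-sym p q = trans
    (cong ∣_∣ (solve 2 (λ p q → p :- q := :- (q :- p)) refl p q))
    (ℚ.∣-p∣≡∣p∣ (q - p))

  ∣p∣≤∣q∣+∣p-q∣ : ∀ p q → ∣ p ∣ ≤ ∣ q ∣ + ∣ p - q ∣
  ∣p∣≤∣q∣+∣p-q∣ p q = subst (λ t → ∣ t ∣ ≤ ∣ q ∣ + ∣ p - q ∣)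
    (solve 2 (λ p q → q :+ (p :- q) := p) refl p q)
    (ℚ.∣p+q∣≤∣p∣+∣q∣ q (p - q))

  ∣p-q∣≤ : ∀ {p q ε} → p ≤ q + ε → q ≤ p + ε → ∣ p - q ∣ ≤ ε
  ∣p-q∣≤ {p} {q} {ε} p≤ q≤ with ℚ.∣p∣≡p∨∣p∣≡-p (p - q)
  ... | inj₁ eq = subst₂ _≤_ (sym eq)
        (solve 2 (λ q e → (q :+ e) :+ :- q := e) refl q ε) (ℚ.+-monoˡ-≤ (- q) p≤)
  ... | inj₂ eq = subst₂ _≤_
        (trans (solve 2 (λ p q → q :+ :- p := :- (p :- q)) refl p q) (sym eq))
        (solve 2 (λ p e → (p :+ e) :+ :- p := e) refl p ε) (ℚ.+-monoˡ-≤ (- p) q≤)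

-- ⌊√n⌋
isqrt : ℕ → ℕ
isqrt zero    = 0
isqrt (suc n) with suc (isqrt n) ℕ.* suc (isqrt n) ℕ.≤? suc n
... | yes _ = suc (isqrt n)
... | no  _ = isqrt n

isqrt-lower : ∀ n → isqrt n ℕ.* isqrt n ℕ.≤ n
isqrt-lower zero    = ℕ.z≤n
isqrt-lower (suc n) with suc (isqrt n) ℕ.* suc (isqrt n) ℕ.≤? suc n
... | yes p = p
... | no  _ = ℕ.m≤n⇒m≤1+n (isqrt-lower n)

isqrt-upper : ∀ n → n ℕ.< suc (isqrt n) ℕ.* suc (isqrt n)
isqrt-upper zero    = ℕ.s≤s ℕ.z≤n
isqrt-upper (suc n) with suc (isqrt n) ℕ.* suc (isqrt n) ℕ.≤? suc n
... | yes _ = ℕ.≤-<-trans (isqrt-upper n)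
                (ℕ.*-mono-< (ℕ.n<1+n (suc (isqrt n))) (ℕ.n<1+n (suc (isqrt n))))
... | no ¬p = ℕ.≰⇒> ¬p

-- ⌊√⌊∣q∣(n+1)²⌋⌋
sqrtNum : ℕ → ℚ → ℕ
sqrtNum n q = isqrt ((ℤ.∣ ℚ.numerator q ∣ ℕ.* (suc n ℕ.* suc n)) ℕ./ ℚ.denominatorℕ q)

-- The largest multiple of 1/(n+1) that is ≤ √∣q∣.
sqrtApprox : ℕ → ℚ → ℚ
sqrtApprox n q = + sqrtNum n q / suc n

private
  toℚᵘ-/ : ∀ i n → toℚᵘ (i / suc n) ℚᵘ.≃ mkℚᵘ i n
  toℚᵘ-/ i n = ℚ.toℚᵘ-fromℚᵘ (mkℚᵘ i n)

  toℚᵘ-square : ∀ i n → toℚᵘ ((i / suc n) * (i / suc n)) ℚᵘ.≃ mkℚᵘ i n ℚᵘ.* mkℚᵘ i n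
  toℚᵘ-square i n = ℚᵘ.≃-trans (ℚ.toℚᵘ-homo-* (i / suc n) (i / suc n))
    (ℚᵘ.*-cong {toℚᵘ (i / suc n)} {mkℚᵘ i n} {toℚᵘ (i / suc n)} {mkℚᵘ i n}
      (toℚᵘ-/ i n) (toℚᵘ-/ i n))

  /-nonNeg : ∀ m n → 0ℚ ≤ + m / suc n
  /-nonNeg m n = ℚ.nonNegative⁻¹ (+ m / suc n) {{ℚ.normalize-nonNeg m (suc n)}}

  /-suc : ∀ m n → + suc m / suc n ≡ + m / suc n + + 1 / suc n
  /-suc m n = ℚ.toℚᵘ-injective (ℚᵘ.≃-trans (toℚᵘ-/ (+ suc m) n) (ℚᵘ.≃-sym
    (ℚᵘ.≃-trans (ℚ.toℚᵘ-homo-+ (+ m / suc n) (+ 1 / suc n)) (ℚᵘ.≃-trans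
      (ℚᵘ.+-cong {toℚᵘ (+ m / suc n)} {mkℚᵘ (+ m) n} {toℚᵘ (+ 1 / suc n)} {mkℚᵘ (+ 1) n}
        (toℚᵘ-/ (+ m) n) (toℚᵘ-/ (+ 1) n))
      (*≡* (trans
        (S.solve 2 (λ m N → (m S.:* N S.:+ S.con (+ 1) S.:* N) S.:* N
                      S.:= (S.con (+ 1) S.:+ m) S.:* (N S.:* N)) refl (+ m) (+ suc n))
        (cong (+ suc m ℤ.*_) (sym (ℤ.pos-* (suc n) (suc n))))))))))
    where module S = ℤ-Solver.+-*-Solver

sqrtApprox-nonNeg : ∀ n q → 0ℚ ≤ sqrtApprox n q
sqrtApprox-nonNeg n q = /-nonNeg (sqrtNum n q) n

sqrtApprox-lower : ∀ n q → sqrtApprox n q * sqrtApprox n q ≤ ∣ q ∣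
sqrtApprox-lower n q@(mkℚ i d _) = ℚ.toℚᵘ-cancel-≤ (ℚᵘ.≤-respˡ-≃
  (ℚᵘ.≃-sym (toℚᵘ-square (+ r) n)) (*≤* (subst₂ ℤ._≤_
    (trans (ℤ.pos-* (r ℕ.* r) (suc d)) (cong (ℤ._* + suc d) (ℤ.pos-* r r)))
    (ℤ.pos-* ℤ.∣ i ∣ (suc n ℕ.* suc n)) (ℤ.+≤+ bound))))
  where
  r = sqrtNum n q
  A = ℤ.∣ i ∣ ℕ.* (suc n ℕ.* suc n)
  bound : r ℕ.* r ℕ.* suc d ℕ.≤ A
  bound = ℕ.≤-trans (ℕ.*-monoˡ-≤ (suc d) (isqrt-lower (A ℕ./ suc d))) (ℕ.m/n*n≤m A (suc d))

sqrtApprox-upper : ∀ n q → ∣ q ∣ ≤ (sqrtApprox n q + + 1 / suc n) * (sqrtApprox n q + + 1 / suc n)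
sqrtApprox-upper n q@(mkℚ i d _) = subst (λ t → ∣ q ∣ ≤ t * t) (/-suc r n)
  (ℚ.toℚᵘ-cancel-≤ (ℚᵘ.≤-respʳ-≃ (ℚᵘ.≃-sym (toℚᵘ-square (+ suc r) n)) (*≤* (subst₂ ℤ._≤_
    (ℤ.pos-* ℤ.∣ i ∣ (suc n ℕ.* suc n))
    (trans (ℤ.pos-* (suc r ℕ.* suc r) (suc d)) (cong (ℤ._* + suc d) (ℤ.pos-* (suc r) (suc r))))
    (ℤ.+≤+ bound)))))
  where
  r = sqrtNum n q
  A = ℤ.∣ i ∣ ℕ.* (suc n ℕ.* suc n)
  bound : A ℕ.≤ suc r ℕ.* suc r ℕ.* suc d
  bound = ℕ.≤-trans
    (ℕ.≤-trans (ℕ.≤-reflexive (ℕ.m≡m%n+[m/n]*n A (suc d)))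
               (ℕ.+-monoˡ-≤ (A ℕ./ suc d ℕ.* suc d) (ℕ.<⇒≤ (ℕ.m%n<n A (suc d)))))
    (ℕ.*-monoˡ-≤ (suc d) (isqrt-upper (A ℕ./ suc d)))

-- A real number is a Cauchy sequence of rationals; equality of reals is _≃ʳ_, not _≡_.
IsCauchy : (ℕ → ℚ) → Set
IsCauchy f = ∀ ε → 0ℚ < ε → ∃ λ N → ∀ m n → N ℕ.≤ m → N ℕ.≤ n → ∣ f m - f n ∣ ≤ ε

record ℝ : Set where
  constructor mkℝ
  field
    seq    : ℕ → ℚ
    cauchy : IsCauchy seq

open ℝ public

infix 4 _≃ʳ_ _≤ʳ_

_≃ʳ_ : ℝ → ℝ → Set
x ≃ʳ y = ∀ ε → 0ℚ < ε → ∃ λ N → ∀ n → N ℕ.≤ n → ∣ seq x n - seq y n ∣ ≤ ε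

_≤ʳ_ : ℝ → ℝ → Set
x ≤ʳ y = ∀ ε → 0ℚ < ε → ∃ λ N → ∀ n → N ℕ.≤ n → seq x n ≤ seq y n + ε

private
  const-cauchy : ∀ q → IsCauchy (λ _ → q)
  const-cauchy q ε ε>0 = 0 , λ _ _ _ _ →
    subst (λ t → ∣ t ∣ ≤ ε) (sym (ℚ.+-inverseʳ q)) (ℚ.<⇒≤ ε>0)

  +-cauchy : ∀ {f g} → IsCauchy f → IsCauchy g → IsCauchy (λ n → f n + g n)
  +-cauchy {f} {g} cf cg ε ε>0 with cf (½ * ε) (½*-pos ε>0) | cg (½ * ε) (½*-pos ε>0)
  ... | N₁ , p | N₂ , q = N₁ ℕ.⊔ N₂ , λ m n N≤m N≤n →
    subst₂ _≤_
      (cong ∣_∣ (solve 4 (λ a b c d → (a :- c) :+ (b :- d) := (a :+ b) :- (c :+ d)) refl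
                  (f m) (g m) (f n) (g n)))
      (½+½ ε)
      (ℚ.≤-trans (ℚ.∣p+q∣≤∣p∣+∣q∣ (f m - f n) (g m - g n))
        (ℚ.+-mono-≤ (p m n (ℕ.m⊔n≤o⇒m≤o N₁ N₂ N≤m) (ℕ.m⊔n≤o⇒m≤o N₁ N₂ N≤n))
                    (q m n (ℕ.m⊔n≤o⇒n≤o N₁ N₂ N≤m) (ℕ.m⊔n≤o⇒n≤o N₁ N₂ N≤n))))

  neg-cauchy : ∀ {f} → IsCauchy f → IsCauchy (λ n → - f n)
  neg-cauchy {f} cf ε ε>0 with cf ε ε>0
  ... | N , p = N , λ m n N≤m N≤n →
    subst (_≤ ε)
      (trans (∣-∣-sym (f m) (f n))
        (cong ∣_∣ (solve 2 (λ a b → b :- a := :- a :- :- b) refl (f m) (f n))))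
      (p m n N≤m N≤n)

  eventually-bounded : ∀ {f} → IsCauchy f → ∃₂ λ B N → 0ℚ ≤ B × (∀ n → N ℕ.≤ n → ∣ f n ∣ ≤ B)
  eventually-bounded {f} cf with cf 1ℚ (ℚ.positive⁻¹ 1ℚ)
  ... | N , p = ∣ f N ∣ + 1ℚ , N
      , ℚ.+-mono-≤ (ℚ.0≤∣p∣ (f N)) (ℚ.nonNegative⁻¹ 1ℚ)
      , λ n N≤n → ℚ.≤-trans (∣p∣≤∣q∣+∣p-q∣ (f n) (f N))
          (ℚ.+-monoʳ-≤ ∣ f N ∣ (p n N N≤n ℕ.≤-refl))

  divide : ∀ C ε → 0ℚ < C → 0ℚ < ε → ∃ λ δ → 0ℚ < δ × C * δ ≡ ε
  divide C ε C>0 ε>0 = ε * ℚ.1/ C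
    , *-pos ε>0 (ℚ.positive⁻¹ (ℚ.1/ C) {{ℚ.1/pos⇒pos C}})
    , trans (solve 3 (λ c e d → c :* (e :* d) := e :* (c :* d)) refl C ε (ℚ.1/ C))
        (trans (cong (ε *_) (ℚ.*-inverseʳ C)) (ℚ.*-identityʳ ε))
    where instance
      _ = ℚ.positive C>0
      _ = ℚ.pos⇒nonZero C

  *-close : ∀ {a b c d A B δ ε} → 0ℚ ≤ δ → 0ℚ ≤ B → ∣ a ∣ ≤ A → ∣ d ∣ ≤ B →
            ∣ a - c ∣ ≤ δ → ∣ b - d ∣ ≤ δ → (A + B + 1ℚ) * δ ≡ ε →
            ∣ a * b - c * d ∣ ≤ ε
  *-close {a} {b} {c} {d} {A} {B} {δ} {ε} δ≥0 B≥0 a≤A d≤B a-c b-d eq = begin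
    ∣ a * b - c * d ∣
      ≡⟨ cong ∣_∣ (solve 4 (λ a b c d → a :* b :- c :* d := a :* (b :- d) :+ (a :- c) :* d)
           refl a b c d) ⟩
    ∣ a * (b - d) + (a - c) * d ∣
      ≤⟨ ℚ.∣p+q∣≤∣p∣+∣q∣ (a * (b - d)) ((a - c) * d) ⟩
    ∣ a * (b - d) ∣ + ∣ (a - c) * d ∣
      ≡⟨ cong₂ _+_ (ℚ.∣p*q∣≡∣p∣*∣q∣ a (b - d)) (ℚ.∣p*q∣≡∣p∣*∣q∣ (a - c) d) ⟩
    ∣ a ∣ * ∣ b - d ∣ + ∣ a - c ∣ * ∣ d ∣
      ≤⟨ ℚ.+-mono-≤ (*-mono-≤ (ℚ.0≤∣p∣ a) δ≥0 a≤A b-d)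
                    (*-mono-≤ (ℚ.0≤∣p∣ (a - c)) B≥0 a-c d≤B) ⟩
    A * δ + δ * B
      ≡⟨ sym (ℚ.+-identityʳ _) ⟩
    A * δ + δ * B + 0ℚ
      ≤⟨ ℚ.+-monoʳ-≤ (A * δ + δ * B) δ≥0 ⟩
    A * δ + δ * B + δ
      ≡⟨ solve 3 (λ a b d → a :* d :+ d :* b :+ d := (a :+ b :+ con 1ℚ) :* d) refl A B δ ⟩
    (A + B + 1ℚ) * δ
      ≡⟨ eq ⟩
    ε ∎
    where open ℚ.≤-Reasoning

  0<A+B+1 : ∀ {A B} → 0ℚ ≤ A → 0ℚ ≤ B → 0ℚ < A + B + 1ℚ
  0<A+B+1 {A} {B} A≥0 B≥0 = ℚ.+-mono-≤-< {0ℚ} {A + B} {0ℚ} {1ℚ}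
    (ℚ.+-mono-≤ {0ℚ} {A} {0ℚ} {B} A≥0 B≥0) (ℚ.positive⁻¹ 1ℚ)

  *-cauchy : ∀ {f g} → IsCauchy f → IsCauchy g → IsCauchy (λ n → f n * g n)
  *-cauchy {f} {g} cf cg ε ε>0 =
    let A , N₁ , A≥0 , f≤A = eventually-bounded cf
        B , N₂ , B≥0 , g≤B = eventually-bounded cg
        δ , δ>0 , eq       = divide (A + B + 1ℚ) ε (0<A+B+1 A≥0 B≥0) ε>0
        N₃ , F             = cf δ δ>0
        N₄ , G             = cg δ δ>0
    in (N₁ ℕ.⊔ N₂) ℕ.⊔ (N₃ ℕ.⊔ N₄) , λ m n hm hn →
      *-close {f m} {g m} {f n} {g n} {A} {B} {δ} {ε} (ℚ.<⇒≤ δ>0) B≥0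
        (f≤A m (ℕ.m⊔n≤o⇒m≤o N₁ N₂ (ℕ.m⊔n≤o⇒m≤o (N₁ ℕ.⊔ N₂) (N₃ ℕ.⊔ N₄) hm)))
        (g≤B n (ℕ.m⊔n≤o⇒n≤o N₁ N₂ (ℕ.m⊔n≤o⇒m≤o (N₁ ℕ.⊔ N₂) (N₃ ℕ.⊔ N₄) hn)))
        (F m n (ℕ.m⊔n≤o⇒m≤o N₃ N₄ (ℕ.m⊔n≤o⇒n≤o (N₁ ℕ.⊔ N₂) (N₃ ℕ.⊔ N₄) hm))
               (ℕ.m⊔n≤o⇒m≤o N₃ N₄ (ℕ.m⊔n≤o⇒n≤o (N₁ ℕ.⊔ N₂) (N₃ ℕ.⊔ N₄) hn)))
        (G m n (ℕ.m⊔n≤o⇒n≤o N₃ N₄ (ℕ.m⊔n≤o⇒n≤o (N₁ ℕ.⊔ N₂) (N₃ ℕ.⊔ N₄) hm))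
               (ℕ.m⊔n≤o⇒n≤o N₃ N₄ (ℕ.m⊔n≤o⇒n≤o (N₁ ℕ.⊔ N₂) (N₃ ℕ.⊔ N₄) hn)))
        eq

  archimedean : ∀ ε → 0ℚ < ε → ∃ λ N → ∀ n → N ℕ.≤ n → + 1 / suc n ≤ ε
  archimedean (mkℚ (+ 0) d _) (ℚ.*<* (ℤ.+<+ ()))
  archimedean (mkℚ ℤ.+[1+ k ] d _) _ = d , λ n d≤n → ℚ.toℚᵘ-cancel-≤
    (ℚᵘ.≤-respˡ-≃ (ℚᵘ.≃-sym (toℚᵘ-/ (+ 1) n))
      (*≤* (ℤ.+≤+ (ℕ.*-mono-≤ {1} {suc k} (ℕ.s≤s ℕ.z≤n) (ℕ.s≤s d≤n)))))

  -- If s² ≤ p, q ≤ (t + u)² and p ≤ q + h² with u ≤ h, then s ≤ t + 2h.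
  sqrt-close : ∀ {s t u h p q} → 0ℚ ≤ s → 0ℚ ≤ t → 0ℚ ≤ u → 0ℚ < h → u ≤ h →
               s * s ≤ p → q ≤ (t + u) * (t + u) → p ≤ q + h * h → s ≤ t + (h + h)
  sqrt-close {s} {t} {u} {h} {p} {q} s≥0 t≥0 u≥0 h>0 u≤h s²≤p q≤ p≤
    with s ℚ.≤? t + (h + h)
  ... | yes s≤ = s≤
  ... | no s≰  = contradiction (ℚ.<-≤-trans above below) (ℚ.<-irrefl refl)
    where
    a = t + (h + h)
    a<s : a < s
    a<s = ℚ.≰⇒> s≰
    h≥0 : 0ℚ ≤ h
    h≥0 = ℚ.<⇒≤ h>0
    h²≥0 : 0ℚ ≤ h * h
    h²≥0 = ℚ.<⇒≤ (*-pos h>0 h>0)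
    t+u≤t+h : t + u ≤ t + h
    t+u≤t+h = ℚ.+-monoʳ-≤ t u≤h
    a>0 : 0ℚ < a
    a>0 = ℚ.+-mono-≤-< {0ℚ} {t} {0ℚ} {h + h} t≥0 (ℚ.+-mono-< {0ℚ} {h} {0ℚ} {h} h>0 h>0)
    th≥0 : 0ℚ ≤ h * t
    th≥0 = subst (_≤ h * t) (ℚ.*-zeroʳ h) (ℚ.*-monoˡ-≤-nonNeg h {{ℚ.nonNegative h≥0}} t≥0)
    rest≥0 : 0ℚ ≤ (h * t + h * t) + (h * h + h * h)
    rest≥0 = ℚ.+-mono-≤ {0ℚ} {h * t + h * t} {0ℚ} {h * h + h * h}
      (ℚ.+-mono-≤ {0ℚ} {h * t} {0ℚ} {h * t} th≥0 th≥0)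
      (ℚ.+-mono-≤ {0ℚ} {h * h} {0ℚ} {h * h} h²≥0 h²≥0)
    open ℚ.≤-Reasoning
    below : s * s ≤ (t + h) * (t + h) + h * h
    below = begin
      s * s                         ≤⟨ s²≤p ⟩
      p                             ≤⟨ p≤ ⟩
      q + h * h                     ≤⟨ ℚ.+-monoˡ-≤ (h * h) q≤ ⟩
      (t + u) * (t + u) + h * h     ≤⟨ ℚ.+-monoˡ-≤ (h * h) (*-mono-≤ {t + u} {t + h} {t + u} {t + h}
                                         (ℚ.+-mono-≤ {0ℚ} {t} {0ℚ} {u} t≥0 u≥0)
                                         (ℚ.+-mono-≤ {0ℚ} {t} {0ℚ} {h} t≥0 h≥0)
                                         t+u≤t+h t+u≤t+h) ⟩
      (t + h) * (t + h) + h * h     ∎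
    above : (t + h) * (t + h) + h * h < s * s
    above = begin-strict
      (t + h) * (t + h) + h * h
        ≡⟨ sym (ℚ.+-identityʳ _) ⟩
      (t + h) * (t + h) + h * h + 0ℚ
        ≤⟨ ℚ.+-monoʳ-≤ ((t + h) * (t + h) + h * h) rest≥0 ⟩
      (t + h) * (t + h) + h * h + ((h * t + h * t) + (h * h + h * h))
        ≡⟨ solve 2 (λ t h → (t :+ h) :* (t :+ h) :+ h :* h :+ ((h :* t :+ h :* t) :+ (h :* h :+ h :* h))
                         := (t :+ (h :+ h)) :* (t :+ (h :+ h))) refl t h ⟩
      a * a
        <⟨ ℚ.*-monoʳ-<-pos a {{ℚ.positive a>0}} a<s ⟩
      a * s
        ≤⟨ ℚ.*-monoʳ-≤-nonNeg s {{ℚ.nonNegative s≥0}} (ℚ.<⇒≤ a<s) ⟩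
      s * s ∎

  sqrt-cauchy : ∀ {f} → IsCauchy f → IsCauchy (λ n → sqrtApprox n (f n))
  sqrt-cauchy {f} cf ε ε>0 =
    let h>0   = ½*-pos ε>0
        N₁ , F = cf ((½ * ε) * (½ * ε)) (*-pos h>0 h>0)
        N₂ , R = archimedean (½ * ε) h>0
        close : ∀ m n → N₁ ℕ.⊔ N₂ ℕ.≤ m → N₁ ℕ.⊔ N₂ ℕ.≤ n →
                sqrtApprox m (f m) ≤ sqrtApprox n (f n) + ε
        close m n hm hn = subst (λ t → sqrtApprox m (f m) ≤ sqrtApprox n (f n) + t) (½+½ ε)
          (sqrt-close {sqrtApprox m (f m)} {sqrtApprox n (f n)} {+ 1 / suc n} {½ * ε} {∣ f m ∣} {∣ f n ∣}
            (sqrtApprox-nonNeg m (f m)) (sqrtApprox-nonNeg n (f n)) (/-nonNeg 1 n) h>0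
            (R n (ℕ.m⊔n≤o⇒n≤o N₁ N₂ hn))
            (sqrtApprox-lower m (f m)) (sqrtApprox-upper n (f n))
            (ℚ.≤-trans (∣p∣≤∣q∣+∣p-q∣ (f m) (f n))
              (ℚ.+-monoʳ-≤ ∣ f n ∣ (F m n (ℕ.m⊔n≤o⇒m≤o N₁ N₂ hm) (ℕ.m⊔n≤o⇒m≤o N₁ N₂ hn)))))
    in N₁ ℕ.⊔ N₂ , λ m n hm hn → ∣p-q∣≤ {sqrtApprox m (f m)} {sqrtApprox n (f n)} {ε}
         (close m n hm hn) (close n m hn hm)

fromℚ : ℚ → ℝ
fromℚ q = mkℝ (λ _ → q) (const-cauchy q)

infixl 6 _+ʳ_
infixl 7 _*ʳ_
infix  8 -ʳ_

_+ʳ_ : ℝ → ℝ → ℝ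
mkℝ f cf +ʳ mkℝ g cg = mkℝ (λ n → f n + g n) (+-cauchy {f} {g} cf cg)

-ʳ_ : ℝ → ℝ
-ʳ mkℝ f cf = mkℝ (λ n → - f n) (neg-cauchy {f} cf)

_*ʳ_ : ℝ → ℝ → ℝ
mkℝ f cf *ʳ mkℝ g cg = mkℝ (λ n → f n * g n) (*-cauchy {f} {g} cf cg)

-- √∣x∣, a total function agreeing with √x for x ≥ 0.
sqrtʳ : ℝ → ℝ
sqrtʳ (mkℝ f cf) = mkℝ (λ n → sqrtApprox n (f n)) (sqrt-cauchy {f} cf)

record ℂ : Set where
  constructor _+i_
  field
    re im : ℝ

open ℂ public

infixl 6 _+ᶜ_
infixl 7 _*ᶜ_

ofReal : ℝ → ℂ
ofReal x = x +i fromℚ 0ℚ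

0ᶜ : ℂ
0ᶜ = ofReal (fromℚ 0ℚ)

_+ᶜ_ : ℂ → ℂ → ℂ
(a +i b) +ᶜ (c +i d) = (a +ʳ c) +i (b +ʳ d)

_*ᶜ_ : ℂ → ℂ → ℂ
(a +i b) *ᶜ (c +i d) = (a *ʳ c +ʳ -ʳ (b *ʳ d)) +i (a *ʳ d +ʳ b *ʳ c)

conj : ℂ → ℂ
conj (a +i b) = a +i (-ʳ b)

∣_∣ᶜ : ℂ → ℝ
∣ a +i b ∣ᶜ = sqrtʳ (a *ʳ a +ʳ b *ʳ b)

∑ : {A : Set} → List A → (A → ℂ) → ℂ
∑ xs f = foldr _+ᶜ_ 0ᶜ (map f xs)

infix 5 ∑
syntax ∑ xs (λ x → e) = ∑[ x ∈ xs ] e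

-- A finite set is a list without repetitions. A finite interval of ℤ is a set of the
-- form [a , b] ∩ ℤ; it is empty when b < a.
IsInterval : List ℤ → Set
IsInterval I = ∃₂ λ a b → ∀ m → m ∈ I ⇔ (a ℤ.≤ m × m ℤ.≤ b)

max⁺ : List⁺ ℕ → ℕ
max⁺ (k ∷ ks) = max k ks

min⁺ : List⁺ ℕ → ℕ
min⁺ (k ∷ ks) = min k ks

{-# OPTIONS --safe #-}

-- Van der Corput's argument.  Extend f by zero outside I.  Every shift I + k with k ∈ K lies in an
-- interval J with M + max K − min K elements, so |K| ∑_I f = ∑_{n ∈ J} g(n) with
-- g(n) = ∑_{k ∈ K} f(n − k), and Cauchy–Schwarz over J bounds the square of this by |J| ∑_J g².
-- Expanding g² and substituting m = n − k₁ gives the correlation sum on the right.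
-- Real and imaginary parts satisfy this separately, already for the rational approximations at
-- each index, where the rational square root errs on the favourable side.
module Submission where

open import Algebra.Bundles using (CommutativeMonoid; AbelianGroup)
open import Data.Integer using (ℤ; +_; _+_; _-_)
import Data.Integer as ℤ
import Data.Integer.Properties as ℤ
open import Algebra.Properties.Group (AbelianGroup.group ℤ.+-0-abelianGroup) using (∙-cancelˡ; ∙-cancelʳ)
open import Data.Integer.Properties using (_≟_)
import Data.Integer.Solver as ℤ-Solver
open import Data.List using (List; []; _∷_; foldr; map; length; filter; upTo)
open import Data.List.Extrema.Nat using (min≤⊤; min≤xs; ⊥≤max; xs≤max)
open import Data.List.Membership.DecPropositional _≟_ using (_∈?_)
open import Data.List.Membership.Propositional using (_∈_; _∉_)
open import Data.List.Membership.Propositional.Properties using (∈-map⁺; ∈-map⁻; ∈-upTo⁺; ∈-upTo⁻; ∈-filter⁺; ∈-filter⁻)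
open import Data.List.Membership.Propositional.Properties.WithK using (unique∧set⇒bag)
open import Data.List.NonEmpty using (List⁺; _∷_; toList) renaming (length to length⁺)
open import Data.List.Properties using (length-map; length-upTo)
open import Data.List.Relation.Binary.BagAndSetEquality using (∼bag⇒↭)
open import Data.List.Relation.Binary.Permutation.Propositional using (_↭_; ↭-refl; ↭⇒↭ₛ)
open import Data.List.Relation.Binary.Permutation.Propositional.Properties using (↭-length; ∈-resp-↭; map⁺)
open import Data.List.Relation.Binary.Permutation.Setoid.Properties using (foldr-commMonoid)
open import Data.List.Relation.Binary.Subset.Propositional using (_⊆_)
import Data.List.Relation.Unary.All as All
open import Data.List.Relation.Unary.Any using (here; there)
open import Data.List.Relation.Unary.Unique.Propositional using (Unique)
import Data.List.Relation.Unary.Unique.Propositional.Properties as Unique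
open import Data.Nat using (ℕ; suc; _^_)
import Data.Nat as ℕ
import Data.Nat.Properties as ℕ
open import Data.Product using (∃; _×_; _,_; proj₁; proj₂)
open import Data.Rational using (ℚ; 0ℚ; 1ℚ; _/_; toℚᵘ)
import Data.Rational as ℚ
import Data.Rational.Properties as ℚ
open import Data.Rational.Solver using (module +-*-Solver)
import Data.Rational.Unnormalised as ℚᵘ
import Data.Rational.Unnormalised.Properties as ℚᵘ
open import Data.Sum using (inj₁; inj₂)
open import Function using (_∘_)
open import Function.Bundles using (Equivalence; mk⇔)
open import Relation.Binary.PropositionalEquality using (_≡_; refl; sym; trans; cong; cong₂; subst; subst₂; module ≡-Reasoning)
open import Relation.Nullary using (¬_; yes; no; contradiction)
open import Relation.Unary using (Decidable)
open import Defs

open +-*-Solver using (solve; _:=_; _:+_; _:*_; _:-_; :-_; con)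

private
  variable
    A B : Set

-- Finite sums of rationals

sumℚ : List A → (A → ℚ) → ℚ
sumℚ xs f = foldr ℚ._+_ 0ℚ (map f xs)

infix 5 sumℚ
syntax sumℚ xs (λ x → e) = ∑ℚ[ x ∈ xs ] e

sum-cong-∈ : ∀ (xs : List A) {f g : A → ℚ} → (∀ {x} → x ∈ xs → f x ≡ g x) → sumℚ xs f ≡ sumℚ xs g
sum-cong-∈ []       f≗g = refl
sum-cong-∈ (x ∷ xs) f≗g = cong₂ ℚ._+_ (f≗g (here refl)) (sum-cong-∈ xs (f≗g ∘ there))

sum-cong : ∀ (xs : List A) {f g : A → ℚ} → (∀ x → f x ≡ g x) → sumℚ xs f ≡ sumℚ xs g
sum-cong xs f≗g = sum-cong-∈ xs (λ {x} _ → f≗g x)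

sum-0 : ∀ (xs : List A) → (∑ℚ[ _ ∈ xs ] 0ℚ) ≡ 0ℚ
sum-0 []       = refl
sum-0 (x ∷ xs) = trans (ℚ.+-identityˡ _) (sum-0 xs)

sum-+ : ∀ (xs : List A) f g → (∑ℚ[ x ∈ xs ] f x ℚ.+ g x) ≡ sumℚ xs f ℚ.+ sumℚ xs g
sum-+ []       f g = refl
sum-+ (x ∷ xs) f g = trans (cong (f x ℚ.+ g x ℚ.+_) (sum-+ xs f g))
  (solve 4 (λ a b c d → (a :+ b) :+ (c :+ d) := (a :+ c) :+ (b :+ d)) refl
    (f x) (g x) (sumℚ xs f) (sumℚ xs g))

sum-neg : ∀ (xs : List A) f → (∑ℚ[ x ∈ xs ] ℚ.- f x) ≡ ℚ.- sumℚ xs f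
sum-neg []       f = refl
sum-neg (x ∷ xs) f = trans (cong (ℚ.- f x ℚ.+_) (sum-neg xs f)) (sym (ℚ.neg-distrib-+ (f x) (sumℚ xs f)))

sum-*ˡ : ∀ (xs : List A) c f → (∑ℚ[ x ∈ xs ] c ℚ.* f x) ≡ c ℚ.* sumℚ xs f
sum-*ˡ []       c f = sym (ℚ.*-zeroʳ c)
sum-*ˡ (x ∷ xs) c f = trans (cong (c ℚ.* f x ℚ.+_) (sum-*ˡ xs c f)) (sym (ℚ.*-distribˡ-+ c (f x) (sumℚ xs f)))

sum-*ʳ : ∀ (xs : List A) c f → (∑ℚ[ x ∈ xs ] f x ℚ.* c) ≡ sumℚ xs f ℚ.* c
sum-*ʳ xs c f = trans (sum-cong xs (λ x → ℚ.*-comm (f x) c)) (trans (sum-*ˡ xs c f) (ℚ.*-comm c (sumℚ xs f)))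

sum-swap : ∀ (xs : List A) (ys : List B) (f : A → B → ℚ) →
  (∑ℚ[ x ∈ xs ] ∑ℚ[ y ∈ ys ] f x y) ≡ (∑ℚ[ y ∈ ys ] ∑ℚ[ x ∈ xs ] f x y)
sum-swap []       ys f = sym (sum-0 ys)
sum-swap (x ∷ xs) ys f = trans (cong (sumℚ ys (f x) ℚ.+_) (sum-swap xs ys f))
  (sym (sum-+ ys (f x) (λ y → ∑ℚ[ x ∈ xs ] f x y)))

sum-map : ∀ (g : A → B) xs f → sumℚ (map g xs) f ≡ (∑ℚ[ x ∈ xs ] f (g x))
sum-map g []       f = refl
sum-map g (x ∷ xs) f = cong (f (g x) ℚ.+_) (sum-map g xs f)

sum-↭ : ∀ {xs ys : List A} f → xs ↭ ys → sumℚ xs f ≡ sumℚ ys f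
sum-↭ f p = foldr-commMonoid ℚ-+-0.setoid ℚ-+-0.isCommutativeMonoid (↭⇒↭ₛ (map⁺ f p))
  where module ℚ-+-0 = CommutativeMonoid ℚ.+-0-commutativeMonoid

-- `f` and `g` may differ where `P` fails, so that removing the filter and passing to a zero
-- extension is a single step.
sum-filter : ∀ {P : A → Set} (P? : Decidable P) xs {f g : A → ℚ} →
  (∀ {x} → x ∈ xs → P x → f x ≡ g x) → (∀ {x} → ¬ P x → g x ≡ 0ℚ) →
  sumℚ (filter P? xs) f ≡ sumℚ xs g
sum-filter P? []       f≗g g≗0 = refl
sum-filter P? (x ∷ xs) {f} {g} f≗g g≗0 with P? x
... | yes Px = cong₂ ℚ._+_ (f≗g (here refl) Px) (sum-filter P? xs (f≗g ∘ there) g≗0)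
... | no ¬Px = trans (sum-filter P? xs (f≗g ∘ there) g≗0)
      (sym (trans (cong (ℚ._+ sumℚ xs g) (g≗0 ¬Px)) (ℚ.+-identityˡ _)))

-- Without repetitions every multiplicity is 0 or 1, so having the same members already means being
-- the same bag.
unique∧⊆∧⊇⇒↭ : ∀ {xs ys : List A} → Unique xs → Unique ys → xs ⊆ ys → ys ⊆ xs → xs ↭ ys
unique∧⊆∧⊇⇒↭ ux uy xs⊆ys ys⊆xs = ∼bag⇒↭ (unique∧set⇒bag ux uy (mk⇔ xs⊆ys ys⊆xs))

-- Filtering `ys` by membership in `xs` drops only zero terms and leaves a permutation of `xs`.
sum-⊆ : ∀ {xs ys : List ℤ} {f : ℤ → ℚ} → Unique xs → Unique ys → xs ⊆ ys →
  (∀ {y} → y ∉ xs → f y ≡ 0ℚ) → sumℚ ys f ≡ sumℚ xs f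
sum-⊆ {xs} {ys} {f} ux uy xs⊆ys f≗0 = trans
  (sym (sum-filter (_∈? xs) ys (λ _ _ → refl) f≗0))
  (sum-↭ f (unique∧⊆∧⊇⇒↭ (Unique.filter⁺ (_∈? xs) {ys} uy) ux
    (λ x∈ → proj₂ (∈-filter⁻ (_∈? xs) {xs = ys} x∈)) (λ x∈ → ∈-filter⁺ (_∈? xs) (xs⊆ys x∈) x∈)))

-- Squares and the Cauchy-Schwarz inequality

0≤p*p : ∀ p → 0ℚ ℚ.≤ p ℚ.* p
0≤p*p p with ℚ.≤-total 0ℚ p
... | inj₁ 0≤p = ℚ.nonNegative⁻¹ (p ℚ.* p) {{ℚ.nonNeg*nonNeg⇒nonNeg p {{ℚ.nonNegative 0≤p}} p {{ℚ.nonNegative 0≤p}}}}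
... | inj₂ p≤0 = ℚ.nonNegative⁻¹ (p ℚ.* p) {{ℚ.nonPos*nonPos⇒nonPos p {{ℚ.nonPositive p≤0}} p {{ℚ.nonPositive p≤0}}}}

p≤p+q : ∀ p {q} → 0ℚ ℚ.≤ q → p ℚ.≤ p ℚ.+ q
p≤p+q p {q} 0≤q = subst (ℚ._≤ p ℚ.+ q) (ℚ.+-identityʳ p) (ℚ.+-monoʳ-≤ p 0≤q)

-- Entry by entry this is 2ca ≤ c² + a², with slack (c - a)². It controls the cross term in the
-- induction for `cauchy-schwarz`.
sum-AM-GM : ∀ (xs : List A) c f →
  c ℚ.* sumℚ xs f ℚ.+ c ℚ.* sumℚ xs f ℚ.≤ (∑ℚ[ _ ∈ xs ] 1ℚ) ℚ.* (c ℚ.* c) ℚ.+ (∑ℚ[ x ∈ xs ] f x ℚ.* f x)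
sum-AM-GM []       c f = ℚ.≤-reflexive (solve 1 (λ c → c :* con 0ℚ :+ c :* con 0ℚ := con 0ℚ :* (c :* c) :+ con 0ℚ) refl c)
sum-AM-GM (x ∷ xs) c f = begin
  c ℚ.* (a ℚ.+ s) ℚ.+ c ℚ.* (a ℚ.+ s)
    ≡⟨ solve 3 (λ c a s → c :* (a :+ s) :+ c :* (a :+ s) := (c :* a :+ c :* a) :+ (c :* s :+ c :* s)) refl c a s ⟩
  (c ℚ.* a ℚ.+ c ℚ.* a) ℚ.+ (c ℚ.* s ℚ.+ c ℚ.* s)
    ≤⟨ ℚ.+-mono-≤ (p≤p+q (c ℚ.* a ℚ.+ c ℚ.* a) (0≤p*p (c ℚ.- a))) (sum-AM-GM xs c f) ⟩
  ((c ℚ.* a ℚ.+ c ℚ.* a) ℚ.+ (c ℚ.- a) ℚ.* (c ℚ.- a)) ℚ.+ (n ℚ.* (c ℚ.* c) ℚ.+ q)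
    ≡⟨ solve 4 (λ c a n q → ((c :* a :+ c :* a) :+ (c :- a) :* (c :- a)) :+ (n :* (c :* c) :+ q)
         := (con 1ℚ :+ n) :* (c :* c) :+ (a :* a :+ q)) refl c a n q ⟩
  (1ℚ ℚ.+ n) ℚ.* (c ℚ.* c) ℚ.+ (a ℚ.* a ℚ.+ q) ∎
  where
  open ℚ.≤-Reasoning
  a = f x
  s = sumℚ xs f
  n = ∑ℚ[ _ ∈ xs ] 1ℚ
  q = ∑ℚ[ x ∈ xs ] f x ℚ.* f x

-- Induction through (a + s)² = a² + 2as + s²: `sum-AM-GM` with `c` equal to the head value bounds
-- 2as, the induction hypothesis bounds s², and the bounds add up to (1 + n)(a² + q).
cauchy-schwarz : ∀ (xs : List A) f →
  sumℚ xs f ℚ.* sumℚ xs f ℚ.≤ (∑ℚ[ _ ∈ xs ] 1ℚ) ℚ.* (∑ℚ[ x ∈ xs ] f x ℚ.* f x)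
cauchy-schwarz []       f = ℚ.≤-refl
cauchy-schwarz (x ∷ xs) f = begin
  (a ℚ.+ s) ℚ.* (a ℚ.+ s)
    ≡⟨ solve 2 (λ a s → (a :+ s) :* (a :+ s) := a :* a :+ ((a :* s :+ a :* s) :+ s :* s)) refl a s ⟩
  a ℚ.* a ℚ.+ ((a ℚ.* s ℚ.+ a ℚ.* s) ℚ.+ s ℚ.* s)
    ≤⟨ ℚ.+-monoʳ-≤ (a ℚ.* a) (ℚ.+-mono-≤ (sum-AM-GM xs a f) (cauchy-schwarz xs f)) ⟩
  a ℚ.* a ℚ.+ ((n ℚ.* (a ℚ.* a) ℚ.+ q) ℚ.+ n ℚ.* q)
    ≡⟨ solve 3 (λ a n q → a :* a :+ ((n :* (a :* a) :+ q) :+ n :* q) := (con 1ℚ :+ n) :* (a :* a :+ q)) refl a n q ⟩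
  (1ℚ ℚ.+ n) ℚ.* (a ℚ.* a ℚ.+ q) ∎
  where
  open ℚ.≤-Reasoning
  a = f x
  s = sumℚ xs f
  n = ∑ℚ[ _ ∈ xs ] 1ℚ
  q = ∑ℚ[ x ∈ xs ] f x ℚ.* f x

-- Integers and fractions as rationals

toℚᵘ-/ : ∀ i n → toℚᵘ (i / suc n) ℚᵘ.≃ ℚᵘ.mkℚᵘ i n
toℚᵘ-/ i n = ℚ.toℚᵘ-fromℚᵘ (ℚᵘ.mkℚᵘ i n)

-- Normalisation blocks computation with `_/_`; in `ℚᵘ` numerators and denominators multiply
-- literally, and `toℚᵘ` is injective.
/-* : ∀ i j m n → (i / suc m) ℚ.* (j / suc n) ≡ (i ℤ.* j) / (suc m ℕ.* suc n)
/-* i j m n = ℚ.toℚᵘ-injective (begin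
  toℚᵘ ((i / suc m) ℚ.* (j / suc n))         ≈⟨ ℚ.toℚᵘ-homo-* (i / suc m) (j / suc n) ⟩
  toℚᵘ (i / suc m) ℚᵘ.* toℚᵘ (j / suc n)     ≈⟨ ℚᵘ.*-cong (toℚᵘ-/ i m) (toℚᵘ-/ j n) ⟩
  -- `mkℚᵘ` stores the denominator minus one, here the predecessor of `suc m ℕ.* suc n`.
  ℚᵘ.mkℚᵘ i m ℚᵘ.* ℚᵘ.mkℚᵘ j n              ≈⟨ toℚᵘ-/ (i ℤ.* j) (n ℕ.+ m ℕ.* suc n) ⟨
  toℚᵘ ((i ℤ.* j) / (suc m ℕ.* suc n))       ∎)
  where open ℚᵘ.≃-Reasoning

/-+ : ∀ i j → (i / 1) ℚ.+ (j / 1) ≡ (i + j) / 1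
/-+ i j = ℚ.toℚᵘ-injective (begin
  toℚᵘ ((i / 1) ℚ.+ (j / 1))         ≈⟨ ℚ.toℚᵘ-homo-+ (i / 1) (j / 1) ⟩
  toℚᵘ (i / 1) ℚᵘ.+ toℚᵘ (j / 1)     ≈⟨ ℚᵘ.+-cong (toℚᵘ-/ i 0) (toℚᵘ-/ j 0) ⟩
  ℚᵘ.mkℚᵘ i 0 ℚᵘ.+ ℚᵘ.mkℚᵘ j 0       ≡⟨ cong₂ (λ i j → ℚᵘ.mkℚᵘ (i + j) 0) (ℤ.*-identityʳ i) (ℤ.*-identityʳ j) ⟩
  ℚᵘ.mkℚᵘ (i + j) 0                  ≈⟨ toℚᵘ-/ (i + j) 0 ⟨
  toℚᵘ ((i + j) / 1)                 ∎)
  where open ℚᵘ.≃-Reasoning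

/-*-cancel : ∀ i n → (i / suc n) ℚ.* (+ suc n / 1) ≡ i / 1
/-*-cancel i n = ℚ.toℚᵘ-injective (begin
  toℚᵘ ((i / suc n) ℚ.* (+ suc n / 1))         ≈⟨ ℚ.toℚᵘ-homo-* (i / suc n) (+ suc n / 1) ⟩
  toℚᵘ (i / suc n) ℚᵘ.* toℚᵘ (+ suc n / 1)     ≈⟨ ℚᵘ.*-cong (toℚᵘ-/ i n) (toℚᵘ-/ (+ suc n) 0) ⟩
  ℚᵘ.mkℚᵘ i n ℚᵘ.* ℚᵘ.mkℚᵘ (+ suc n) 0          ≈⟨ ℚᵘ.*≡* (trans (ℤ.*-identityʳ (i ℤ.* + suc n))
                                                    (cong (λ k → i ℤ.* + suc k) (sym (ℕ.*-identityʳ n)))) ⟩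
  ℚᵘ.mkℚᵘ i 0                                  ≈⟨ toℚᵘ-/ i 0 ⟨
  toℚᵘ (i / 1)                                 ∎)
  where open ℚᵘ.≃-Reasoning

sum-1 : ∀ (xs : List A) → (∑ℚ[ _ ∈ xs ] 1ℚ) ≡ + length xs / 1
sum-1 []       = refl
sum-1 (x ∷ xs) = trans (cong (1ℚ ℚ.+_) (sum-1 xs)) (/-+ (+ 1) (+ length xs))

-- Intervals of ℤ

range : ℤ → ℕ → List ℤ
range a n = map (λ i → a + + i) (upTo n)

range-unique : ∀ a n → Unique (range a n)
range-unique a n = Unique.map⁺ (λ eq → ℤ.+-injective (∙-cancelˡ a _ _ eq)) (Unique.upTo⁺ n)

length-range : ∀ a n → length (range a n) ≡ n
length-range a n = trans (length-map (λ i → a + + i) (upTo n)) (length-upTo n)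

∈-range⁺ : ∀ {n i} a → i ℕ.< n → a + + i ∈ range a n
∈-range⁺ a i<n = ∈-map⁺ (λ i → a + + i) (∈-upTo⁺ i<n)

∈-range⁻ : ∀ {m n} a → m ∈ range a n → ∃ λ i → i ℕ.< n × m ≡ a + + i
∈-range⁻ a m∈ with ∈-map⁻ (λ i → a + + i) m∈
... | i , i∈ , eq = i , ∈-upTo⁻ i∈ , eq

i≤j⇒j≡i+n : ∀ {i j} → i ℤ.≤ j → ∃ λ n → j ≡ i + + n
i≤j⇒j≡i+n {i} {j} i≤j = ℤ.∣ j - i ∣ , trans
  (S.solve 2 (λ i j → j S.:= i S.:+ (j S.:- i)) refl i j)
  (cong (λ t → i + t) (sym (ℤ.0≤i⇒+∣i∣≡i (ℤ.i≤j⇒0≤j-i i≤j))))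
  where module S = ℤ-Solver.+-*-Solver

+-cancelˡ-≤ : ∀ i {j k} → i + j ℤ.≤ i + k → j ℤ.≤ k
+-cancelˡ-≤ i le = ℤ.≮⇒≥ (λ k<j → ℤ.<⇒≱ (ℤ.+-monoʳ-< i k<j) le)

-- `IsInterval` fixes only membership; an explicit run of consecutive integers can be counted and
-- shifted.
interval-↭-range : ∀ {I} → Unique I → IsInterval I → ∃ λ a → I ↭ range a (length I)
-- For an empty interval the endpoints may be reversed; any start serves, here 0.
interval-↭-range {[]}         uI I-int = + 0 , ↭-refl
interval-↭-range {I@(m₀ ∷ _)} uI (a , b , ∈⇔) =
  a , subst (λ l → I ↭ range a l) (sym (trans (↭-length I↭) (length-range a (suc (proj₁ d))))) I↭
  where
  -- The head of `I` witnesses `a ≤ b`. Both endpoints belong to the interval, hence `suc (proj₁ d)`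
  -- integers.
  m₀-bounds = Equivalence.to (∈⇔ m₀) (here refl)
  d : ∃ λ n → b ≡ a + + n
  d = i≤j⇒j≡i+n (ℤ.≤-trans (proj₁ m₀-bounds) (proj₂ m₀-bounds))
  I⊆ : I ⊆ range a (suc (proj₁ d))
  I⊆ {m} m∈ with Equivalence.to (∈⇔ m) m∈
  ... | a≤m , m≤b with i≤j⇒j≡i+n a≤m
  ... | i , refl = ∈-range⁺ a (ℕ.s≤s (ℤ.drop‿+≤+ (+-cancelˡ-≤ a (subst (a + + i ℤ.≤_) (proj₂ d) m≤b))))
  ⊆I : range a (suc (proj₁ d)) ⊆ I
  ⊆I {m} m∈ with ∈-range⁻ a m∈
  ... | i , i<n , refl = Equivalence.from (∈⇔ m)
    (ℤ.i≤i+j a (+ i) , subst (a + + i ℤ.≤_) (sym (proj₂ d)) (ℤ.+-monoʳ-≤ a (ℤ.+≤+ (ℕ.s≤s⁻¹ i<n))))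
  I↭ : I ↭ range a (suc (proj₁ d))
  I↭ = unique∧⊆∧⊇⇒↭ uI (range-unique a (suc (proj₁ d))) I⊆ ⊆I

-- If m = a + i, then m + k is a + p plus the offset i + (k - p), which is below |I| + (q - p). So
-- one run starting at a + p holds all the shifts.
shifted-window : ∀ {I Ks p q} → Unique I → IsInterval I → p ℕ.≤ q → (∀ {k} → k ∈ Ks → p ℕ.≤ k × k ℕ.≤ q) →
  ∃ λ J → Unique J × + length J ≡ + length I + + q - + p × (∀ {m k} → m ∈ I → k ∈ Ks → m + + k ∈ J)
shifted-window {I} {Ks} {p} {q} uI I-int p≤q bounds with interval-↭-range uI I-int
... | a , I↭ = range (a + + p) L , range-unique (a + + p) L
    , trans (cong +_ (length-range (a + + p) L)) L≡ , covers
  where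
  L = length I ℕ.+ (q ℕ.∸ p)
  L≡ : + L ≡ + length I + + q - + p
  -- `p≤q` makes the truncated difference in `L` the true integer difference.
  L≡ = trans (cong (λ t → + length I + t) (trans (sym (ℤ.⊖-≥ p≤q)) (sym (ℤ.m-n≡m⊖n q p))))
    (sym (ℤ.+-assoc (+ length I) (+ q) (ℤ.- + p)))
  covers : ∀ {m k} → m ∈ I → k ∈ Ks → m + + k ∈ range (a + + p) L
  covers {m} {k} m∈ k∈ with ∈-range⁻ a (∈-resp-↭ I↭ m∈)
  ... | i , i<n , refl = subst (_∈ range (a + + p) L) eq
      (∈-range⁺ (a + + p) (ℕ.+-mono-<-≤ i<n (ℕ.∸-monoˡ-≤ p (proj₂ (bounds k∈)))))
    where
    module S = ℤ-Solver.+-*-Solver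
    eq : a + + p + + (i ℕ.+ (k ℕ.∸ p)) ≡ a + + i + + k
    eq = trans
      (S.solve 4 (λ a p i r → a S.:+ p S.:+ (i S.:+ r) S.:= a S.:+ i S.:+ (r S.:+ p)) refl a (+ p) (+ i) (+ (k ℕ.∸ p)))
      (cong (λ t → a + + i + + t) (ℕ.m∸n+n≡m (proj₁ (bounds k∈))))

-- Correlation sums

extend : List ℤ → (ℤ → ℚ) → ℤ → ℚ
extend I f m with m ∈? I
... | yes _ = f m
... | no  _ = 0ℚ

extend-∈ : ∀ {I m} f → m ∈ I → extend I f m ≡ f m
extend-∈ {I} {m} f m∈ with m ∈? I
... | yes _  = refl
... | no m∉ = contradiction m∈ m∉

extend-∉ : ∀ {I m} f → m ∉ I → extend I f m ≡ 0ℚ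
extend-∉ {I} {m} f m∉ with m ∈? I
... | yes m∈ = contradiction m∈ m∉
... | no _   = refl

-- Two functions, because the imaginary part of the complex sum mixes the real and imaginary parts
-- of the data.
correlation : List ℤ → List ℕ → (ℤ → ℚ) → (ℤ → ℚ) → ℚ
correlation I Ks f g = ∑ℚ[ k₁ ∈ Ks ] ∑ℚ[ k₂ ∈ Ks ]
  ∑ℚ[ m ∈ filter (λ m → (m + + k₁ - + k₂) ∈? I) I ] f m ℚ.* g (m + + k₁ - + k₂)

-- Summing all shifts over a common window

module Window {I J : List ℤ} {Ks : List ℕ} (uI : Unique I) (uJ : Unique J)
  (covers : ∀ {m k} → m ∈ I → k ∈ Ks → m + + k ∈ J) where

  -- Substitute m = n - k: the translate of `J` by -k contains `I`, and its further points
  -- contribute zero.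
  sum-shift : ∀ {k} {f : ℤ → ℚ} → k ∈ Ks → (∀ {m} → m ∉ I → f m ≡ 0ℚ) →
    (∑ℚ[ n ∈ J ] f (n - + k)) ≡ sumℚ I f
  sum-shift {k} {f} k∈ f≗0 = trans (sym (sum-map (_- + k) J f))
    (sum-⊆ uI (Unique.map⁺ (λ {m} {n} → ∙-cancelʳ (ℤ.- + k) m n) uJ) I⊆ f≗0)
    where
    module S = ℤ-Solver.+-*-Solver
    I⊆ : I ⊆ map (_- + k) J
    I⊆ {m} m∈ = subst (_∈ map (_- + k) J)
      (S.solve 2 (λ m k → (m S.:+ k) S.:- k S.:= m) refl m (+ k))
      (∈-map⁺ (_- + k) (covers m∈ k∈))

  -- The convolution of the zero extension of `f` with the counting measure of `Ks`; this is g in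
  -- the sketch above.
  smooth : (ℤ → ℚ) → ℤ → ℚ
  smooth f n = ∑ℚ[ k ∈ Ks ] extend I f (n - + k)

  -- After the sums are swapped, each `k` sees the whole of `I` inside the window and contributes
  -- the same total.
  sum-smooth : ∀ f → sumℚ J (smooth f) ≡ (∑ℚ[ _ ∈ Ks ] 1ℚ) ℚ.* sumℚ I f
  sum-smooth f = begin
    (∑ℚ[ n ∈ J ] ∑ℚ[ k ∈ Ks ] extend I f (n - + k))   ≡⟨ sum-swap J Ks _ ⟩
    (∑ℚ[ k ∈ Ks ] ∑ℚ[ n ∈ J ] extend I f (n - + k))   ≡⟨ sum-cong-∈ Ks (λ k∈ → sum-shift k∈ (extend-∉ f)) ⟩
    (∑ℚ[ _ ∈ Ks ] sumℚ I (extend I f))                ≡⟨ sum-cong Ks (λ _ → sum-cong-∈ I (extend-∈ f)) ⟩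
    (∑ℚ[ _ ∈ Ks ] sumℚ I f)                           ≡⟨ sum-cong Ks (λ _ → sym (ℚ.*-identityˡ _)) ⟩
    (∑ℚ[ _ ∈ Ks ] 1ℚ ℚ.* sumℚ I f)                    ≡⟨ sum-*ʳ Ks (sumℚ I f) (λ _ → 1ℚ) ⟩
    (∑ℚ[ _ ∈ Ks ] 1ℚ) ℚ.* sumℚ I f                    ∎
    where open ≡-Reasoning

  -- The zero extension of `g` takes over the role of the filter; then n = m + k₁ moves the sum to
  -- the window.
  correlation-term : ∀ {k₁ k₂} f g → k₁ ∈ Ks →
    (∑ℚ[ m ∈ filter (λ m → (m + + k₁ - + k₂) ∈? I) I ] f m ℚ.* g (m + + k₁ - + k₂))
      ≡ (∑ℚ[ n ∈ J ] extend I f (n - + k₁) ℚ.* extend I g (n - + k₂))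
  correlation-term {k₁} {k₂} f g k₁∈ = begin
    (∑ℚ[ m ∈ filter (λ m → (m + + k₁ - + k₂) ∈? I) I ] f m ℚ.* g (m + + k₁ - + k₂))
      ≡⟨ sum-filter (λ m → (m + + k₁ - + k₂) ∈? I) I
           (λ m∈ m′∈ → sym (cong₂ ℚ._*_ (extend-∈ f m∈) (extend-∈ g m′∈)))
           (λ {m} m′∉ → trans (cong (extend I f m ℚ.*_) (extend-∉ g m′∉)) (ℚ.*-zeroʳ (extend I f m))) ⟩
    (∑ℚ[ m ∈ I ] extend I f m ℚ.* extend I g (m + + k₁ - + k₂))
      -- The summand vanishes off `I` through its first factor.
      ≡⟨ sum-shift k₁∈ (λ {m} m∉ → trans (cong (ℚ._* extend I g (m + + k₁ - + k₂)) (extend-∉ f m∉))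
           (ℚ.*-zeroˡ (extend I g (m + + k₁ - + k₂)))) ⟨
    (∑ℚ[ n ∈ J ] extend I f (n - + k₁) ℚ.* extend I g (n - + k₁ + + k₁ - + k₂))
      ≡⟨ sum-cong J (λ n → cong (λ t → extend I f (n - + k₁) ℚ.* extend I g (t - + k₂))
           (S.solve 2 (λ n k → (n S.:- k) S.:+ k S.:= n) refl n (+ k₁))) ⟩
    (∑ℚ[ n ∈ J ] extend I f (n - + k₁) ℚ.* extend I g (n - + k₂)) ∎
    where
    open ≡-Reasoning
    module S = ℤ-Solver.+-*-Solver

  -- With n as the outermost variable, the sums over k₁ and k₂ separate into a product.
  correlation≡ : ∀ f g → correlation I Ks f g ≡ (∑ℚ[ n ∈ J ] smooth f n ℚ.* smooth g n)
  correlation≡ f g = begin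
    correlation I Ks f g
      ≡⟨ sum-cong-∈ Ks (λ k₁∈ → sum-cong Ks (λ _ → correlation-term f g k₁∈)) ⟩
    (∑ℚ[ k₁ ∈ Ks ] ∑ℚ[ k₂ ∈ Ks ] ∑ℚ[ n ∈ J ] extend I f (n - + k₁) ℚ.* extend I g (n - + k₂))
      ≡⟨ sum-cong Ks (λ _ → sum-swap Ks J _) ⟩
    (∑ℚ[ k₁ ∈ Ks ] ∑ℚ[ n ∈ J ] ∑ℚ[ k₂ ∈ Ks ] extend I f (n - + k₁) ℚ.* extend I g (n - + k₂))
      ≡⟨ sum-swap Ks J _ ⟩
    (∑ℚ[ n ∈ J ] ∑ℚ[ k₁ ∈ Ks ] ∑ℚ[ k₂ ∈ Ks ] extend I f (n - + k₁) ℚ.* extend I g (n - + k₂))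
      ≡⟨ sum-cong J (λ n → sum-cong Ks (λ k₁ → sum-*ˡ Ks (extend I f (n - + k₁)) (λ k₂ → extend I g (n - + k₂)))) ⟩
    (∑ℚ[ n ∈ J ] ∑ℚ[ k₁ ∈ Ks ] extend I f (n - + k₁) ℚ.* smooth g n)
      ≡⟨ sum-cong J (λ n → sum-*ʳ Ks (smooth g n) (λ k₁ → extend I f (n - + k₁))) ⟩
    (∑ℚ[ n ∈ J ] smooth f n ℚ.* smooth g n) ∎
    where open ≡-Reasoning

  -- The window form is an inner product, whose symmetry is evident. This is what makes the
  -- imaginary part of the right-hand side vanish.
  correlation-comm : ∀ f g → correlation I Ks f g ≡ correlation I Ks g f
  correlation-comm f g = trans (correlation≡ f g)
    (trans (sum-cong J (λ n → ℚ.*-comm (smooth f n) (smooth g n))) (sym (correlation≡ g f)))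

  -- Cauchy-Schwarz for `smooth f` on `J`, with the division by N² postponed.
  van-der-corput : ∀ f → let N = + length Ks / 1 in
    (N ℚ.* sumℚ I f) ℚ.* (N ℚ.* sumℚ I f) ℚ.≤ (+ length J / 1) ℚ.* correlation I Ks f f
  van-der-corput f = subst₂ ℚ._≤_
    (cong (λ t → t ℚ.* t) (trans (sum-smooth f) (cong (ℚ._* sumℚ I f) (sum-1 Ks))))
    (cong₂ ℚ._*_ (sum-1 J) (sym (correlation≡ f f)))
    (cauchy-schwarz J (smooth f))

-- Multiplying the goal by N² > 0 clears its denominator and turns it into the hypothesis.
*-cancel-square : ∀ {s t i} n → let N = + suc n / 1 in
  (N ℚ.* s) ℚ.* (N ℚ.* s) ℚ.≤ (i / 1) ℚ.* t → s ℚ.* s ℚ.≤ (i / (suc n ^ 2)) ℚ.* t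
*-cancel-square {s} {t} {i} n le = ℚ.*-cancelˡ-≤-pos N² {{ℚ.normalize-pos (suc n ^ 2) 1}} (begin
  N² ℚ.* (s ℚ.* s)                   ≡⟨ cong (ℚ._* (s ℚ.* s)) N²≡ ⟩
  (N ℚ.* N) ℚ.* (s ℚ.* s)            ≡⟨ solve 2 (λ n s → (n :* n) :* (s :* s) := (n :* s) :* (n :* s)) refl N s ⟩
  (N ℚ.* s) ℚ.* (N ℚ.* s)            ≤⟨ le ⟩
  -- `ℕ.pred` presents the denominator as a successor, the form that `/-*-cancel` expects.
  (i / 1) ℚ.* t                      ≡⟨ cong (ℚ._* t) (/-*-cancel i (ℕ.pred (suc n ^ 2))) ⟨
  ((i / (suc n ^ 2)) ℚ.* N²) ℚ.* t   ≡⟨ solve 3 (λ c n t → (c :* n) :* t := n :* (c :* t)) refl (i / (suc n ^ 2)) N² t ⟩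
  N² ℚ.* ((i / (suc n ^ 2)) ℚ.* t)   ∎)
  where
  open ℚ.≤-Reasoning
  N = + suc n / 1
  N² = + (suc n ^ 2) / 1
  N²≡ : N² ≡ N ℚ.* N
  N²≡ = sym (trans (/-* (+ suc n) (+ suc n) 0 0)
    -- `suc n ^ 2` unfolds with a trailing factor 1, which `ℕ.*-identityʳ` removes.
    (cong (_/ 1) (trans (sym (ℤ.pos-* (suc n) (suc n))) (cong (λ k → + (suc n ℕ.* k)) (sym (ℕ.*-identityʳ (suc n)))))))

-- Reals and complex numbers at a fixed index of their approximating sequences

reₙ imₙ : ℕ → ℂ → ℚ
reₙ n z = seq (re z) n
imₙ n z = seq (im z) n

reₙ-∑ : ∀ n (xs : List A) f → reₙ n (∑ xs f) ≡ (∑ℚ[ x ∈ xs ] reₙ n (f x))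
reₙ-∑ n []       f = refl
reₙ-∑ n (x ∷ xs) f = cong (reₙ n (f x) ℚ.+_) (reₙ-∑ n xs f)

imₙ-∑ : ∀ n (xs : List A) f → imₙ n (∑ xs f) ≡ (∑ℚ[ x ∈ xs ] imₙ n (f x))
imₙ-∑ n []       f = refl
imₙ-∑ n (x ∷ xs) f = cong (imₙ n (f x) ℚ.+_) (imₙ-∑ n xs f)

autocorrelation : List ℤ → List ℕ → (ℤ → ℂ) → ℂ
autocorrelation I Ks x = ∑[ k₁ ∈ Ks ] ∑[ k₂ ∈ Ks ]
  ∑[ m ∈ filter (λ m → (m + + k₁ - + k₂) ∈? I) I ] x m *ᶜ conj (x (m + + k₁ - + k₂))

-- `sqrtApprox` rounds down, so the bound holds at every index without an error term. The absolute
-- value under the root disappears because a sum of squares is nonnegative.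
∣∣²-upper : ∀ n z → seq (∣ z ∣ᶜ *ʳ ∣ z ∣ᶜ) n ℚ.≤ reₙ n z ℚ.* reₙ n z ℚ.+ imₙ n z ℚ.* imₙ n z
∣∣²-upper n z = ℚ.≤-trans (sqrtApprox-lower n _)
  (ℚ.≤-reflexive (ℚ.0≤p⇒∣p∣≡p (ℚ.+-mono-≤ {0ℚ} {reₙ n z ℚ.* reₙ n z} (0≤p*p (reₙ n z)) (0≤p*p (imₙ n z)))))

∀-≤⇒≤ʳ : ∀ {x y} → (∀ n → seq x n ℚ.≤ seq y n) → x ≤ʳ y
∀-≤⇒≤ʳ {x} {y} x≤y ε ε>0 = 0 , λ n _ → ℚ.≤-trans (x≤y n) (p≤p+q (seq y n) (ℚ.<⇒≤ ε>0))

∀-≡⇒≃ʳ : ∀ {x y} → (∀ n → seq x n ≡ seq y n) → x ≃ʳ y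
∀-≡⇒≃ʳ {x} {y} x≡y ε ε>0 = 0 , λ n _ → subst (λ t → ℚ.∣ t ∣ ℚ.≤ ε)
  (sym (trans (cong (ℚ._- seq y n) (x≡y n)) (ℚ.+-inverseʳ (seq y n)))) (ℚ.<⇒≤ ε>0)

-- The innermost list may depend on the outer indices, as the filtered copies of `I` depend on k₁
-- and k₂.
sum³-+ : ∀ {C : Set} (xs : List A) (ys : List B) (zs : A → B → List C) (f g : A → B → C → ℚ) →
  (∑ℚ[ x ∈ xs ] ∑ℚ[ y ∈ ys ] ∑ℚ[ z ∈ zs x y ] f x y z ℚ.+ g x y z) ≡
  (∑ℚ[ x ∈ xs ] ∑ℚ[ y ∈ ys ] ∑ℚ[ z ∈ zs x y ] f x y z) ℚ.+ (∑ℚ[ x ∈ xs ] ∑ℚ[ y ∈ ys ] ∑ℚ[ z ∈ zs x y ] g x y z)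
sum³-+ xs ys zs f g = trans
  (sum-cong xs (λ x → trans (sum-cong ys (λ y → sum-+ (zs x y) (f x y) (g x y))) (sum-+ ys _ _)))
  (sum-+ xs _ _)

sum³-neg : ∀ {C : Set} (xs : List A) (ys : List B) (zs : A → B → List C) (f : A → B → C → ℚ) →
  (∑ℚ[ x ∈ xs ] ∑ℚ[ y ∈ ys ] ∑ℚ[ z ∈ zs x y ] ℚ.- f x y z) ≡ ℚ.- (∑ℚ[ x ∈ xs ] ∑ℚ[ y ∈ ys ] ∑ℚ[ z ∈ zs x y ] f x y z)
sum³-neg xs ys zs f = trans
  (sum-cong xs (λ x → trans (sum-cong ys (λ y → sum-neg (zs x y) (f x y))) (sum-neg ys _)))
  (sum-neg xs _)

-- Real and imaginary parts of the autocorrelation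

module _ (n : ℕ) (I : List ℤ) (Ks : List ℕ) (x : ℤ → ℂ) where
  private
    a b : ℤ → ℚ
    a m = reₙ n (x m)
    b m = imₙ n (x m)

    common : ℕ → ℕ → List ℤ
    common k₁ k₂ = filter (λ m → (m + + k₁ - + k₂) ∈? I) I

  reₙ-autocorrelation : reₙ n (autocorrelation I Ks x) ≡ correlation I Ks a a ℚ.+ correlation I Ks b b
  reₙ-autocorrelation = trans
    (trans (reₙ-∑ n Ks _) (sum-cong Ks (λ k₁ → trans (reₙ-∑ n Ks _) (sum-cong Ks (λ k₂ →
      trans (reₙ-∑ n (common k₁ k₂) _) (sum-cong (common k₁ k₂) (λ m →
        cong (a m ℚ.* a (m + + k₁ - + k₂) ℚ.+_)
          -- One minus sign comes from `_*ᶜ_`, the other from `conj`.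
          (solve 2 (λ p q → :- (p :* :- q) := p :* q) refl (b m) (b (m + + k₁ - + k₂))))))))))
    (sum³-+ Ks Ks common _ _)

  imₙ-autocorrelation : imₙ n (autocorrelation I Ks x) ≡ ℚ.- correlation I Ks a b ℚ.+ correlation I Ks b a
  imₙ-autocorrelation = trans
    (trans (imₙ-∑ n Ks _) (sum-cong Ks (λ k₁ → trans (imₙ-∑ n Ks _) (sum-cong Ks (λ k₂ →
      trans (imₙ-∑ n (common k₁ k₂) _) (sum-cong (common k₁ k₂) (λ m →
        cong (ℚ._+ b m ℚ.* a (m + + k₁ - + k₂))
          (sym (ℚ.neg-distribʳ-* (a m) (b (m + + k₁ - + k₂)))))))))))
    (trans (sum³-+ Ks Ks common _ _) (cong (ℚ._+ correlation I Ks b a) (sum³-neg Ks Ks common _)))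

-- A real factor only rescales the imaginary part, which is a difference of two mixed correlations;
-- `comm` makes them cancel.
im-scaled-autocorrelation : ∀ n {I Ks} x c →
  correlation I Ks (λ m → imₙ n (x m)) (λ m → reₙ n (x m)) ≡ correlation I Ks (λ m → reₙ n (x m)) (λ m → imₙ n (x m)) →
  imₙ n (ofReal (fromℚ c) *ᶜ autocorrelation I Ks x) ≡ 0ℚ
im-scaled-autocorrelation n {I} {Ks} x c comm = begin
  c ℚ.* imₙ n S ℚ.+ 0ℚ ℚ.* reₙ n S   ≡⟨ solve 3 (λ c s r → c :* s :+ con 0ℚ :* r := c :* s) refl c (imₙ n S) (reₙ n S) ⟩
  c ℚ.* imₙ n S                      ≡⟨ cong (c ℚ.*_) (imₙ-autocorrelation n I Ks x) ⟩
  c ℚ.* (ℚ.- corr a b ℚ.+ corr b a)  ≡⟨ cong (λ t → c ℚ.* (ℚ.- corr a b ℚ.+ t)) comm ⟩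
  c ℚ.* (ℚ.- corr a b ℚ.+ corr a b)  ≡⟨ solve 2 (λ c t → c :* (:- t :+ t) := con 0ℚ) refl c (corr a b) ⟩
  0ℚ                                 ∎
  where
  open ≡-Reasoning
  S = autocorrelation I Ks x
  corr = correlation I Ks
  a = λ m → reₙ n (x m)
  b = λ m → imₙ n (x m)

∣∑∣²-upper : ∀ n {I Ks} x c → (∀ f → sumℚ I f ℚ.* sumℚ I f ℚ.≤ c ℚ.* correlation I Ks f f) →
  seq (∣ ∑ I x ∣ᶜ *ʳ ∣ ∑ I x ∣ᶜ) n ℚ.≤ reₙ n (ofReal (fromℚ c) *ᶜ autocorrelation I Ks x)
∣∑∣²-upper n {I} {Ks} x c square≤ = begin
  seq (∣ ∑ I x ∣ᶜ *ʳ ∣ ∑ I x ∣ᶜ) n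
    ≤⟨ ∣∣²-upper n (∑ I x) ⟩
  reₙ n (∑ I x) ℚ.* reₙ n (∑ I x) ℚ.+ imₙ n (∑ I x) ℚ.* imₙ n (∑ I x)
    ≡⟨ cong₂ (λ p q → p ℚ.* p ℚ.+ q ℚ.* q) (reₙ-∑ n I x) (imₙ-∑ n I x) ⟩
  sumℚ I a ℚ.* sumℚ I a ℚ.+ sumℚ I b ℚ.* sumℚ I b
    ≤⟨ ℚ.+-mono-≤ (square≤ a) (square≤ b) ⟩
  c ℚ.* corr a a ℚ.+ c ℚ.* corr b b
    ≡⟨ ℚ.*-distribˡ-+ c (corr a a) (corr b b) ⟨
  c ℚ.* (corr a a ℚ.+ corr b b)
    ≡⟨ cong (c ℚ.*_) (reₙ-autocorrelation n I Ks x) ⟨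
  c ℚ.* reₙ n S
    -- The added zero term is the product of imaginary parts in `_*ᶜ_`, since `ofReal` has imaginary
    -- part 0.
    ≡⟨ solve 3 (λ c r s → c :* r := c :* r :+ :- (con 0ℚ :* s)) refl c (reₙ n S) (imₙ n S) ⟩
  c ℚ.* reₙ n S ℚ.+ ℚ.- (0ℚ ℚ.* imₙ n S) ∎
  where
  open ℚ.≤-Reasoning
  S = autocorrelation I Ks x
  corr = correlation I Ks
  a = λ m → reₙ n (x m)
  b = λ m → imₙ n (x m)

-- Assembling the bound

∈⇒min⁺≤∧≤max⁺ : ∀ {k} K → k ∈ toList K → min⁺ K ℕ.≤ k × k ℕ.≤ max⁺ K
∈⇒min⁺≤∧≤max⁺ (k ∷ ks) (here refl) = min≤⊤ k ks , ⊥≤max k ks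
∈⇒min⁺≤∧≤max⁺ (k ∷ ks) (there k∈)  = All.lookup (min≤xs k ks) k∈ , All.lookup (xs≤max k ks) k∈

-- The right-hand side is spelled out: hidden behind autocorrelation, comparing it with the theorem's
-- would unfold rational arithmetic.
square-bound⇒complex-bound : ∀ {I J Ks} → Unique I → Unique J → (∀ {m k} → m ∈ I → k ∈ Ks → m + + k ∈ J) →
  ∀ x c → (∀ f → sumℚ I f ℚ.* sumℚ I f ℚ.≤ c ℚ.* correlation I Ks f f) →
  let lhs = ∣ ∑ I x ∣ᶜ *ʳ ∣ ∑ I x ∣ᶜ
      rhs = ofReal (fromℚ c) *ᶜ
            (∑[ k₁ ∈ Ks ] ∑[ k₂ ∈ Ks ]
              ∑[ m ∈ filter (λ m → (m + + k₁ - + k₂) ∈? I) I ]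
                x m *ᶜ conj (x (m + + k₁ - + k₂)))
  in im rhs ≃ʳ fromℚ 0ℚ × lhs ≤ʳ re rhs
square-bound⇒complex-bound {I} {J} {Ks} uI uJ covers x c square≤ =
  ∀-≡⇒≃ʳ {im (ofReal (fromℚ c) *ᶜ autocorrelation I Ks x)} {fromℚ 0ℚ}
    (λ n → im-scaled-autocorrelation n {I} {Ks} x c
      (Window.correlation-comm uI uJ covers (λ m → imₙ n (x m)) (λ m → reₙ n (x m)))) ,
  ∀-≤⇒≤ʳ {∣ ∑ I x ∣ᶜ *ʳ ∣ ∑ I x ∣ᶜ} {re (ofReal (fromℚ c) *ᶜ autocorrelation I Ks x)}
    (λ n → ∣∑∣²-upper n {I} {Ks} x c square≤)

-- `i` stands apart from `+ length J` so that the fraction can carry the numerator M + max K - min K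
-- as written. Matching on `k ∷ ks` exposes the length as a successor.
square-bound : ∀ {I J} K → Unique I → Unique J → (∀ {m k} → m ∈ I → k ∈ toList K → m + + k ∈ J) →
  ∀ i → + length J ≡ i → ∀ f →
  sumℚ I f ℚ.* sumℚ I f ℚ.≤ (i / (length⁺ K ^ 2)) ℚ.* correlation I (toList K) f f
square-bound {I} (k ∷ ks) uI uJ covers i refl f =
  *-cancel-square {sumℚ I f} {correlation I (k ∷ ks) f f} {i} (length ks) (Window.van-der-corput uI uJ covers f)

proposition6p14 :
  (I : List ℤ) → Unique I → IsInterval I →
  (M : ℕ) → length I ≡ M →
  (x : ℤ → ℂ) →
  (K : List⁺ ℕ) → Unique (toList K) →
  let lhs = ∣ ∑[ m ∈ I ] x m ∣ᶜ *ʳ ∣ ∑[ m ∈ I ] x m ∣ᶜ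
      rhs = ofReal (fromℚ ((+ M + + max⁺ K - + min⁺ K) / (length⁺ K ^ 2))) *ᶜ
            (∑[ k₁ ∈ toList K ] ∑[ k₂ ∈ toList K ]
              ∑[ m ∈ filter (λ m → (m + + k₁ - + k₂) ∈? I) I ]
                x m *ᶜ conj (x (m + + k₁ - + k₂)))
  in im rhs ≃ʳ fromℚ 0ℚ × lhs ≤ʳ re rhs
proposition6p14 I uI I-int M refl x K uK =
  -- The head of the nonempty `K` lies between the minimum and the maximum, which orders these two.
  let lo , hi = ∈⇒min⁺≤∧≤max⁺ K (here refl)
      J , uJ , lengthJ , covers = shifted-window uI I-int (ℕ.≤-trans lo hi) (∈⇒min⁺≤∧≤max⁺ K)
      i = + length I + + max⁺ K - + min⁺ K
  in square-bound⇒complex-bound {I} {J} {toList K} uI uJ covers x (i / (length⁺ K ^ 2)) (square-bound K uI uJ covers i lengthJ)
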